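{- If $C$ is a sorting network on $n$ channels with depth $d$, then there is a co-saturated sorting network $N$ on $n$ channels with depth $d$.
   Context: Channels are numbered $1,\ldots,n$. A comparator network on $n$ channels of depth $d$ is a sequence $C=L_1;\ldots;L_d$ of layers; each layer is a set of comparators $(i,j)$ with $1\le i<j\le n$, and each channel occurs in at most one comparator of a given layer. An input $\bar x\in\{0,1\}^n$ propagates as follows: $\bar x_0=\bar x$, and $\bar x_k$ is obtained from $\bar x_{k-1}$ by, for each $(i,j)\in L_k$, putting the minimum of the values at positions $i,j$ at position $i$ and the maximum at position $j$. The output is $C(\bar x)=\bar x_d$, and $C$ is a sorting network if $C(\bar x)$ is sorted in non-decreasing order for every $\bar x\in\{0,1\}^n$. A channel is used in layer $L_\ell$ if it occurs in a comparator of $L_\ell$. The last layer $L_d$ is in last layer normal form (llnf) if every comparator in $L_d$ is of the form $(i,i+1)$ and there is no $i<n$ with both $i$ and $i+1$ unused in $L_d$. The blocks (or $(d-1)$-blocks) of $C$ are the vertex sets of connected components of the graph on $\{1,\ldots,n\}$ with an edge $\{i,j\}$ for each comparator $(i,j)\in L_d$; when $L_d$ is in llnf, each block is either a single channel unused in $L_d$ or a pair $\{i,i+1\}$ with $(i,i+1)\in L_d$, and the blocks are ordered top to bottom as consecutive intervals. A sorting network of depth $d$ is co-saturated if: (i) its last layer is in llnf; (ii) there are no two consecutive blocks each of which contains a channel unused in layer $L_{d-1}$; and (iii) whenever $(i,i+1)\in L_d$ and channels $i$ and $i+1$ are both unused in $L_{d-1}$, the channels $i-1$ and $i+2$ (whenever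 they exist, i.e. lie in $\{1,\ldots,n\}$) are used in $L_d$. -}

module Defs where

open import Data.Bool using (Bool; _∧_; _∨_)
import Data.Bool as Bool
open import Data.Fin using (Fin; toℕ; _<_; _≤_)
open import Data.List using (List; []; foldl)
open import Data.List.Membership.Propositional using (_∈_)
open import Data.List.Relation.Unary.All using (All; [])
open import Data.List.Relation.Unary.AllPairs using (AllPairs; [])
open import Data.List.Relation.Unary.Any using (Any)
open import Data.Nat using (ℕ; zero; suc; _∸_)
open import Data.Product using (_×_; _,_; ∃-syntax; uncurry)
open import Data.Sum using (_⊎_)
open import Data.Vec using (Vec; []; _∷_; lookup; _[_]≔_)
open import Level using (0ℓ)
open import Relation.Binary.Construct.Closure.Equivalence using (EqClosure)
open import Relation.Binary.PropositionalEquality using (_≡_)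
open import Relation.Nullary using (¬_)
open import Relation.Unary using (Pred)

private
  variable
    n d : ℕ

Comparator : ℕ → Set
Comparator n = Fin n × Fin n

OccursIn : Fin n → Comparator n → Set
OccursIn k (i , j) = k ≡ i ⊎ k ≡ j

Disjoint : Comparator n → Comparator n → Set
Disjoint c c′ = ∀ k → OccursIn k c → ¬ OccursIn k c′

-- A set of comparators is listed without repetition: `disjoint` forbids
-- a comparator from appearing at two positions of the list.
record Layer (n : ℕ) : Set where
  field
    comparators : List (Comparator n)
    ordered     : All (uncurry _<_) comparators
    disjoint    : AllPairs Disjoint comparators

open Layer public

emptyLayer : Layer n
emptyLayer = record { comparators = [] ; ordered = [] ; disjoint = [] }

Network : ℕ → ℕ → Set
Network n d = Vec (Layer n) d

-- On {0,1} = {false,true}, minimum is _∧_ and maximum is _∨_.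
exchange : Vec Bool n → Comparator n → Vec Bool n
exchange x (i , j) =
  (x [ i ]≔ (lookup x i ∧ lookup x j)) [ j ]≔ (lookup x i ∨ lookup x j)

-- The comparators of a layer act on disjoint pairs of channels, so applying
-- them one after the other, in any order, is applying them simultaneously.
applyLayer : Layer n → Vec Bool n → Vec Bool n
applyLayer L x = foldl exchange x (comparators L)

run : Network n d → Vec Bool n → Vec Bool n
run []      x = x
run (L ∷ C) x = run C (applyLayer L x)

Sorted : Vec Bool n → Set
Sorted x = ∀ i j → i ≤ j → lookup x i Bool.≤ lookup x j

IsSortingNetwork : Network n d → Set
IsSortingNetwork C = ∀ x → Sorted (run C x)

-- Layers are numbered from 1.  Layers that do not exist (relevant to the
-- last two layers of a network of depth at most 1) count as empty.
layer : Network n d → ℕ → Layer n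
layer C       zero          = emptyLayer
layer []      (suc ℓ)       = emptyLayer
layer (L ∷ C) (suc zero)    = L
layer (L ∷ C) (suc (suc ℓ)) = layer C (suc ℓ)

lastLayer : Network n d → Layer n
lastLayer {d = d} C = layer C d

penultimateLayer : Network n d → Layer n
penultimateLayer {d = d} C = layer C (d ∸ 1)

UsedIn : Layer n → Fin n → Set
UsedIn L k = Any (OccursIn k) (comparators L)

UnusedIn : Layer n → Fin n → Set
UnusedIn L k = ¬ UsedIn L k

infix 4 _⋖_

-- j = i + 1
_⋖_ : Fin n → Fin n → Set
i ⋖ j = toℕ j ≡ suc (toℕ i)

record IsLLNF (L : Layer n) : Set where
  field
    adjacent    : ∀ i j → (i , j) ∈ comparators L → i ⋖ j
    noUnusedRun : ∀ i j → i ⋖ j → ¬ (UnusedIn L i × UnusedIn L j)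

Edge : Layer n → Fin n → Fin n → Set
Edge L i j = (i , j) ∈ comparators L

-- The connected component of channel c.  Every block is the block of any of
-- its channels, so quantifying over blocks is quantifying over c.
block : Layer n → Fin n → Pred (Fin n) 0ℓ
block L c k = EqClosure (Edge L) c k

-- B lies entirely above B′ and no channel separates them.
Consecutive : Pred (Fin n) 0ℓ → Pred (Fin n) 0ℓ → Set
Consecutive B B′ =
  (∀ k k′ → B k → B′ k′ → k < k′) ×
  (∃[ k ] ∃[ k′ ] B k × B′ k′ × k ⋖ k′)

record IsCoSaturated (C : Network n d) : Set where
  private
    Last        = lastLayer C
    Penultimate = penultimateLayer C
  field
    llnf : IsLLNF Last
    noConsecutiveUnused :
      ∀ b b′ → Consecutive (block Last b) (block Last b′) →
      ¬ ((∃[ k ] block Last b k × UnusedIn Penultimate k) ×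
         (∃[ k ] block Last b′ k × UnusedIn Penultimate k))
    neighboursUsed :
      ∀ i j → i ⋖ j → (i , j) ∈ comparators Last →
      UnusedIn Penultimate i → UnusedIn Penultimate j →
      (∀ k → k ⋖ i → UsedIn Last k) × (∀ k → j ⋖ k → UsedIn Last k)

{-# OPTIONS --safe #-}
module Submission where

-- A comparator (i , j) of the last layer with i + 1 < j never exchanges
-- anything, so it can be dropped; comparing two adjacent unused channels of
-- the last layer acts on sorted values.  This gives llnf.  After that, any
-- comparator (i , j) between unused channels may be added to the layer before:
-- if it exchanges two values, then, the last layer moving values by at most one
-- channel, (i , j) must itself occur in the last layer, which then only
-- repeats the exchange.  Adding such comparators until at most one channel is
-- unused makes the remaining conditions vacuous.  At depth at most one there
-- is no such layer to modify, but then n ≤ 2.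

open import Data.Bool using (Bool; true; false; _∧_; _∨_; b≤b; f≤t)
import Data.Bool as Bool
import Data.Bool.Properties as Bool
open import Data.Empty using (⊥-elim)
open import Data.Fin using (Fin; zero; suc; toℕ; _≟_; _<_; _<?_)
import Data.Fin.Properties as Fin
open import Data.List using (List; []; _∷_; foldl; filter; allFin; cartesianProduct)
import Data.List as List
open import Data.List.Membership.Propositional using (_∈_; find; lose)
open import Data.List.Membership.Propositional.Properties using (∈-allFin; ∈-cartesianProduct⁺)
open import Data.List.Properties using (foldl-∷ʳ)
open import Data.List.Relation.Unary.All as All using (All; []; _∷_)
import Data.List.Relation.Unary.All.Properties as All
open import Data.List.Relation.Unary.AllPairs using (AllPairs; []; _∷_)
import Data.List.Relation.Unary.AllPairs.Properties as AllPairs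
open import Data.List.Relation.Unary.Any using (Any; here; there; any?)
open import Data.List.Relation.Unary.Any.Properties using (++⁺ˡ; ++⁺ʳ)
open import Data.Nat using (ℕ; zero; suc; z≤n; s≤s; s≤s⁻¹)
import Data.Nat as ℕ
import Data.Nat.Properties as ℕ
open import Data.Product using (_×_; _,_; ∃-syntax; uncurry; proj₁; proj₂)
open import Data.Sum using (_⊎_; inj₁; inj₂)
open import Data.Vec using (Vec; []; _∷_; _∷ʳ_; lookup; _[_]≔_; initLast; replicate)
open import Data.Vec.Properties
  using (lookup∘update; lookup∘update′; []≔-commutes; []≔-lookup)
open import Function using (_∘_)
open import Relation.Binary.Construct.Closure.Equivalence using (return; transitive)
open import Relation.Binary.PropositionalEquality
  using (_≡_; _≢_; refl; sym; trans; cong; cong₂; subst; subst₂; module ≡-Reasoning)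
open import Relation.Nullary using (¬_; Dec; yes; no)
open import Relation.Nullary.Decidable using (¬?; _×-dec_; _⊎-dec_)
open import Relation.Unary using (Pred; Decidable)
open import Defs

private
  variable
    n d : ℕ
    b b′ : Bool
    i j k : Fin n
    c c′ : Comparator n
    cs : List (Comparator n)

-- Order on the Booleans

≰⇒true,false : ¬ b Bool.≤ b′ → b ≡ true × b′ ≡ false
≰⇒true,false {false}         b≰b′ = ⊥-elim (b≰b′ (Bool.≤-minimum _))
≰⇒true,false {true}  {false} b≰b′ = refl , refl
≰⇒true,false {true}  {true}  b≰b′ = ⊥-elim (b≰b′ b≤b)

true≰false : b ≡ true → b′ ≡ false → ¬ b Bool.≤ b′
true≰false refl refl ()

≤false : b Bool.≤ b′ → b′ ≡ false → b ≡ false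
≤false b≤b b′≡false = b′≡false

true≤ : b Bool.≤ b′ → b ≡ true → b′ ≡ true
true≤ b≤b b≡true = b≡true

∧-mono-≤ : ∀ {a a′} → a Bool.≤ a′ → b Bool.≤ b′ → (a ∧ b) Bool.≤ (a′ ∧ b′)
∧-mono-≤               f≤t _   = Bool.≤-minimum _
∧-mono-≤ {a = false}   b≤b _   = b≤b
∧-mono-≤ {a = true}    b≤b b≤b′ = b≤b′

∨-mono-≤ : ∀ {a a′} → a Bool.≤ a′ → b Bool.≤ b′ → (a ∨ b) Bool.≤ (a′ ∨ b′)
∨-mono-≤               f≤t _   = Bool.≤-maximum _
∨-mono-≤ {a = false}   b≤b b≤b′ = b≤b′
∨-mono-≤ {a = true}    b≤b _   = b≤b

≤⇒∧ : b Bool.≤ b′ → b ∧ b′ ≡ b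
≤⇒∧         f≤t = refl
≤⇒∧ {false} b≤b = refl
≤⇒∧ {true}  b≤b = refl

≤⇒∨ : b Bool.≤ b′ → b ∨ b′ ≡ b′
≤⇒∨         f≤t = refl
≤⇒∨ {false} b≤b = refl
≤⇒∨ {true}  b≤b = refl

∧≤∨ : ∀ a b → (a ∧ b) Bool.≤ (a ∨ b)
∧≤∨ false b = Bool.≤-minimum b
∧≤∨ true  b = Bool.≤-maximum b

-- Single exchanges

Ordered : Vec Bool n → Comparator n → Set
Ordered x (i , j) = lookup x i Bool.≤ lookup x j

ordered? : (x : Vec Bool n) → Decidable (Ordered x)
ordered? x (i , j) = lookup x i Bool.≤? lookup x j

exchange-min : (x : Vec Bool n) → i ≢ j →
  lookup (exchange x (i , j)) i ≡ lookup x i ∧ lookup x j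
exchange-min {i = i} x i≢j =
  trans (lookup∘update′ i≢j (x [ i ]≔ _) _) (lookup∘update i x _)

exchange-max : (x : Vec Bool n) →
  lookup (exchange x (i , j)) j ≡ lookup x i ∨ lookup x j
exchange-max {i = i} {j} x = lookup∘update j (x [ i ]≔ _) _

exchange-other : (x : Vec Bool n) → ¬ OccursIn k c →
  lookup (exchange x c) k ≡ lookup x k
exchange-other {c = i , j} x k∉c =
  trans (lookup∘update′ (k∉c ∘ inj₂) (x [ i ]≔ _) _) (lookup∘update′ (k∉c ∘ inj₁) x _)

exchange-ordered : (x : Vec Bool n) → Ordered x c → exchange x c ≡ x
exchange-ordered {c = i , j} x xᵢ≤xⱼ = begin
  (x [ i ]≔ (lookup x i ∧ lookup x j)) [ j ]≔ (lookup x i ∨ lookup x j)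
    ≡⟨ cong₂ (λ p q → (x [ i ]≔ p) [ j ]≔ q) (≤⇒∧ xᵢ≤xⱼ) (≤⇒∨ xᵢ≤xⱼ) ⟩
  (x [ i ]≔ lookup x i) [ j ]≔ lookup x j
    ≡⟨ cong (_[ j ]≔ lookup x j) ([]≔-lookup x i) ⟩
  x [ j ]≔ lookup x j
    ≡⟨ []≔-lookup x j ⟩
  x ∎
  where open ≡-Reasoning

exchange-unordered : (x : Vec Bool n) →
  lookup x i ≡ true → lookup x j ≡ false →
  exchange x (i , j) ≡ (x [ i ]≔ false) [ j ]≔ true
exchange-unordered x xᵢ xⱼ rewrite xᵢ | xⱼ = refl

exchange-idempotent : (x : Vec Bool n) → i ≢ j →
  exchange (exchange x (i , j)) (i , j) ≡ exchange x (i , j)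
exchange-idempotent x i≢j = exchange-ordered _
  (subst₂ Bool._≤_ (sym (exchange-min x i≢j)) (sym (exchange-max x))
    (∧≤∨ (lookup x _) (lookup x _)))

Disjoint-sym : Disjoint c c′ → Disjoint c′ c
Disjoint-sym c#c′ k k∈c′ k∈c = c#c′ k k∈c k∈c′

-- Neither comparator writes to a channel that the other reads or writes, so the writes can be
-- reordered one at a time.
exchange-comm : (x : Vec Bool n) → Disjoint c c′ →
  exchange (exchange x c) c′ ≡ exchange (exchange x c′) c
exchange-comm {c = i , j} {k , l} x c#c′ = begin
  exchange (exchange x (i , j)) (k , l)
    ≡⟨ cong₂ (λ u v → (exchange x (i , j) [ k ]≔ (u ∧ v)) [ l ]≔ (u ∨ v))
         (exchange-other x (c′∌c (inj₁ refl))) (exchange-other x (c′∌c (inj₂ refl))) ⟩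
  (((x [ i ]≔ p) [ j ]≔ q) [ k ]≔ p′) [ l ]≔ q′
    ≡⟨ cong (_[ l ]≔ q′) ([]≔-commutes _ j k (λ { refl → c′∌c (inj₁ refl) (inj₂ refl) })) ⟩
  (((x [ i ]≔ p) [ k ]≔ p′) [ j ]≔ q) [ l ]≔ q′
    ≡⟨ []≔-commutes _ j l (λ { refl → c′∌c (inj₂ refl) (inj₂ refl) }) ⟩
  (((x [ i ]≔ p) [ k ]≔ p′) [ l ]≔ q′) [ j ]≔ q
    ≡⟨ cong (λ y → (y [ l ]≔ q′) [ j ]≔ q)
         ([]≔-commutes x i k (λ { refl → c′∌c (inj₁ refl) (inj₁ refl) })) ⟩
  (((x [ k ]≔ p′) [ i ]≔ p) [ l ]≔ q′) [ j ]≔ q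
    ≡⟨ cong (_[ j ]≔ q) ([]≔-commutes _ i l (λ { refl → c′∌c (inj₂ refl) (inj₁ refl) })) ⟩
  (((x [ k ]≔ p′) [ l ]≔ q′) [ i ]≔ p) [ j ]≔ q
    ≡⟨ cong₂ (λ u v → (exchange x (k , l) [ i ]≔ (u ∧ v)) [ j ]≔ (u ∨ v))
         (exchange-other x (c#c′ i (inj₁ refl))) (exchange-other x (c#c′ j (inj₂ refl))) ⟨
  exchange (exchange x (k , l)) (i , j) ∎
  where
  open ≡-Reasoning
  p  = lookup x i ∧ lookup x j
  q  = lookup x i ∨ lookup x j
  p′ = lookup x k ∧ lookup x l
  q′ = lookup x k ∨ lookup x l
  c′∌c : ∀ {m} → OccursIn m (k , l) → ¬ OccursIn m (i , j)
  c′∌c m∈c′ m∈c = c#c′ _ m∈c m∈c′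

-- Layers as lists of disjoint exchanges

occursIn? : (k : Fin n) → Decidable (OccursIn k)
occursIn? k (i , j) = (k ≟ i) ⊎-dec (k ≟ j)

usedIn? : (L : Layer n) → Decidable (UsedIn L)
usedIn? L k = any? (occursIn? k) (comparators L)

exchanges-unused : (cs : List (Comparator n)) (x : Vec Bool n) → ¬ Any (OccursIn k) cs →
  lookup (foldl exchange x cs) k ≡ lookup x k
exchanges-unused []       x k∉ = refl
exchanges-unused (c ∷ cs) x k∉ =
  trans (exchanges-unused cs _ (k∉ ∘ there)) (exchange-other x (k∉ ∘ here))

-- Comparators listed before `c` commute past it, and all the others leave the channels of `c`
-- alone.
exchanges-∈ : (x : Vec Bool n) → AllPairs Disjoint cs → c ∈ cs → OccursIn k c →
  lookup (foldl exchange x cs) k ≡ lookup (exchange x c) k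
exchanges-∈ {cs = _ ∷ cs} x (c# ∷ _) (here refl) k∈c =
  exchanges-unused cs _ (All.All¬⇒¬Any (All.map (λ c#c′ → c#c′ _ k∈c) c#))
exchanges-∈ {cs = c′ ∷ cs} {c} {k} x (c′# ∷ dis) (there c∈cs) k∈c = begin
  lookup (foldl exchange (exchange x c′) cs) k
    ≡⟨ exchanges-∈ (exchange x c′) dis c∈cs k∈c ⟩
  lookup (exchange (exchange x c′) c) k
    ≡⟨ cong (λ y → lookup y k) (exchange-comm x c′#c) ⟩
  lookup (exchange (exchange x c) c′) k
    ≡⟨ exchange-other (exchange x c) (Disjoint-sym c′#c k k∈c) ⟩
  lookup (exchange x c) k ∎
  where
  open ≡-Reasoning
  c′#c = All.lookup c′# c∈cs

-- The first exchange commutes down the list to its own copy, where idempotence absorbs it.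
exchanges-absorb : (x : Vec Bool n) → AllPairs Disjoint cs → i ≢ j → (i , j) ∈ cs →
  foldl exchange (exchange x (i , j)) cs ≡ foldl exchange x cs
exchanges-absorb {cs = _ ∷ cs} x _ i≢j (here refl) =
  cong (λ y → foldl exchange y cs) (exchange-idempotent x i≢j)
exchanges-absorb {cs = _ ∷ cs} x (c′# ∷ dis) i≢j (there c∈cs) =
  trans (cong (λ y → foldl exchange y cs)
          (exchange-comm x (Disjoint-sym (All.lookup c′# c∈cs))))
        (exchanges-absorb _ dis i≢j c∈cs)

-- Order is asked of the initial vector only: comparators kept before a dropped one are disjoint
-- from it and do not change the values that it compares.
exchanges-filter : ∀ {p} {P : Pred (Comparator n) p} (P? : Decidable P)
  (cs : List (Comparator n)) (x : Vec Bool n) → AllPairs Disjoint cs →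
  All (λ c → ¬ P c → Ordered x c) cs →
  foldl exchange x (filter P? cs) ≡ foldl exchange x cs
exchanges-filter P? []       x _ _ = refl
exchanges-filter P? (c ∷ cs) x (c# ∷ dis) (o ∷ os) with P? c
... | yes _ = exchanges-filter P? cs (exchange x c) dis
  (All.zipWith (λ (c#c′ , o′) ¬P → subst₂ Bool._≤_
      (sym (exchange-other x (Disjoint-sym c#c′ _ (inj₁ refl))))
      (sym (exchange-other x (Disjoint-sym c#c′ _ (inj₂ refl)))) (o′ ¬P))
    (c# , os))
... | no ¬Pc = trans (exchanges-filter P? cs x dis os)
  (cong (λ y → foldl exchange y cs) (sym (exchange-ordered x (o ¬Pc))))

module _ (L : Layer n) where

  comparator-< : (i , j) ∈ comparators L → i < j
  comparator-< = All.lookup (ordered L)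

  applyLayer-unused : (x : Vec Bool n) → UnusedIn L k → lookup (applyLayer L x) k ≡ lookup x k
  applyLayer-unused = exchanges-unused (comparators L)

  applyLayer-min : (x : Vec Bool n) → (i , j) ∈ comparators L →
    lookup (applyLayer L x) i ≡ lookup x i ∧ lookup x j
  applyLayer-min x ij∈L = trans (exchanges-∈ x (disjoint L) ij∈L (inj₁ refl))
    (exchange-min x (Fin.<⇒≢ (comparator-< ij∈L)))

  applyLayer-max : (x : Vec Bool n) → (i , j) ∈ comparators L →
    lookup (applyLayer L x) j ≡ lookup x i ∨ lookup x j
  applyLayer-max x ij∈L = trans (exchanges-∈ x (disjoint L) ij∈L (inj₂ refl))
    (exchange-max x)

-- Greedy saturation of a layer

Free : Layer n → Comparator n → Set
Free L (i , j) = UnusedIn L i × UnusedIn L j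

free? : (L : Layer n) → Decidable (Free L)
free? L (i , j) = ¬? (usedIn? L i) ×-dec ¬? (usedIn? L j)

-- The new comparator goes to the end of the list, so that it acts after the whole of `L`.
extend : (L : Layer n) (c : Comparator n) → uncurry _<_ c → Free L c → Layer n
extend L c c< (i∉L , j∉L) = record
  { comparators = comparators L List.∷ʳ c
  ; ordered     = All.∷ʳ⁺ (ordered L) c<
  ; disjoint    = AllPairs.++⁺ (disjoint L) ([] ∷ [])
      (All.tabulate λ c′∈L → (λ
        { k k∈c′ (inj₁ refl) → i∉L (lose c′∈L k∈c′)
        ; k k∈c′ (inj₂ refl) → j∉L (lose c′∈L k∈c′) }) ∷ [])
  }

applyLayer-extend : (L : Layer n) (c< : uncurry _<_ c) (fr : Free L c) (x : Vec Bool n) →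
  applyLayer (extend L c c< fr) x ≡ exchange (applyLayer L x) c
applyLayer-extend {c = c} L c< fr x = foldl-∷ʳ exchange x c (comparators L)

module _ {p} {R : Pred (Comparator n) p} (R? : Decidable R) (R⇒< : ∀ {c} → R c → uncurry _<_ c)
  {q} (Q : Pred (Layer n) q)
  (step : ∀ L {c} (r : R c) (fr : Free L c) → Q L → Q (extend L c (R⇒< r) fr))
  where

  -- One pass suffices: extending a layer only makes more channels used, so a comparator that has
  -- ceased to be free never becomes free again. The antitonicity component carries this through the
  -- recursion.
  saturate-list : ∀ cs L → Q L →
    ∃[ L′ ] Q L′ × (∀ {c} → Free L′ c → Free L c) × All (λ c → R c → ¬ Free L′ c) cs
  saturate-list []       L QL = L , QL , (λ fr → fr) , []
  saturate-list (c ∷ cs) L QL with R? c ×-dec free? L c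
  ... | no ¬Rf =
    let L′ , QL′ , anti , done = saturate-list cs L QL
    in L′ , QL′ , anti , (λ r fr → ¬Rf (r , anti fr)) ∷ done
  ... | yes (r , fr) =
    let L′ , QL′ , anti , done = saturate-list cs (extend L c (R⇒< r) fr) (step L r fr QL)
    in L′ , QL′
     , (λ (i∉ , j∉) → let i∉′ , j∉′ = anti (i∉ , j∉) in (i∉′ ∘ ++⁺ˡ , j∉′ ∘ ++⁺ˡ))
     -- `c` itself has just been appended, so its first channel is used from here on.
     , (λ _ fr′ → proj₁ (anti fr′) (++⁺ʳ (comparators L) (here (inj₁ refl)))) ∷ done

  -- Serves both modified layers: `R` is adjacency for the last one and plain order for the one
  -- before it; `Q` holds the invariant, sorting included.
  saturate : ∀ L → Q L → ∃[ L′ ] Q L′ × (∀ {c} → R c → ¬ Free L′ c)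
  saturate L QL =
    let L′ , QL′ , _ , done = saturate-list (cartesianProduct (allFin n) (allFin n)) L QL
    in L′ , QL′ , λ {c} → All.lookup done (∈-cartesianProduct⁺ (∈-allFin _) (∈-allFin _))

-- Networks: monotonicity and number of zeros

-- Every network is a succession of exchanges with `i < j`. The invariants fed in are equality with
-- a sorted vector, the number of zeros, and `Swapped`.
run-preserves : ∀ {p} (P : Pred (Vec Bool n) p) →
  (∀ x i j → i < j → P x → P (exchange x (i , j))) →
  (C : Network n d) (x : Vec Bool n) → P x → P (run C x)
run-preserves P exch []      x Px = Px
run-preserves P exch (L ∷ C) x Px = run-preserves P exch C _ (go (ordered L) x Px)
  where
  go : ∀ {cs} → All (uncurry _<_) cs → ∀ x → P x → P (foldl exchange x cs)
  go []         x Px = Px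
  go (i<j ∷ <s) x Px = go <s _ (exch x _ _ i<j Px)

run-fixes-sorted : (C : Network n d) (x : Vec Bool n) → Sorted x → run C x ≡ x
run-fixes-sorted C x x↗ = run-preserves (_≡ x)
  (λ { _ i j i<j refl → exchange-ordered x (x↗ i j (ℕ.<⇒≤ i<j)) }) C x refl

infix 4 _⊑_

_⊑_ : Vec Bool n → Vec Bool n → Set
x ⊑ y = ∀ k → lookup x k Bool.≤ lookup y k

[]≔-mono-⊑ : (x y : Vec Bool n) (i : Fin n) → x ⊑ y → b Bool.≤ b′ → x [ i ]≔ b ⊑ y [ i ]≔ b′
[]≔-mono-⊑ x y i x⊑y b≤b′ k with k ≟ i
... | yes refl = subst₂ Bool._≤_ (sym (lookup∘update i x _)) (sym (lookup∘update i y _)) b≤b′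
... | no  k≢i  =
  subst₂ Bool._≤_ (sym (lookup∘update′ k≢i x _)) (sym (lookup∘update′ k≢i y _)) (x⊑y k)

exchange-mono-⊑ : (x y : Vec Bool n) (c : Comparator n) → x ⊑ y → exchange x c ⊑ exchange y c
exchange-mono-⊑ x y (i , j) x⊑y = []≔-mono-⊑ (x [ i ]≔ _) (y [ i ]≔ _) j
  ([]≔-mono-⊑ x y i x⊑y (∧-mono-≤ (x⊑y i) (x⊑y j))) (∨-mono-≤ (x⊑y i) (x⊑y j))

run-mono-⊑ : (C : Network n d) (x y : Vec Bool n) → x ⊑ y → run C x ⊑ run C y
run-mono-⊑ []      x y x⊑y = x⊑y
run-mono-⊑ (L ∷ C) x y x⊑y = run-mono-⊑ C _ _ (go (comparators L) x y x⊑y)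
  where
  go : ∀ cs x y → x ⊑ y → foldl exchange x cs ⊑ foldl exchange y cs
  go []       x y x⊑y = x⊑y
  go (c ∷ cs) x y x⊑y = go cs _ _ (exchange-mono-⊑ x y c x⊑y)

[]≔false-⊑ : (x : Vec Bool n) (i : Fin n) → x [ i ]≔ false ⊑ x
[]≔false-⊑ x i = subst (x [ i ]≔ false ⊑_) ([]≔-lookup x i)
  ([]≔-mono-⊑ x x i (λ _ → b≤b) (Bool.≤-minimum _))

⊑-[]≔true : (x : Vec Bool n) (i : Fin n) → x ⊑ x [ i ]≔ true
⊑-[]≔true x i = subst (_⊑ x [ i ]≔ true) ([]≔-lookup x i)
  ([]≔-mono-⊑ x x i (λ _ → b≤b) (Bool.≤-maximum _))

-- The quantity that every network conserves; it determines a sorted output completely.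
zeros : Vec Bool n → ℕ
zeros []          = 0
zeros (false ∷ x) = suc (zeros x)
zeros (true  ∷ x) = zeros x

zeros-[]≔true : (x : Vec Bool n) (i : Fin n) → lookup x i ≡ false →
  zeros x ≡ suc (zeros (x [ i ]≔ true))
zeros-[]≔true (false ∷ x) zero    refl = refl
zeros-[]≔true (false ∷ x) (suc i) xᵢ   = cong suc (zeros-[]≔true x i xᵢ)
zeros-[]≔true (true  ∷ x) (suc i) xᵢ   = zeros-[]≔true x i xᵢ

zeros-[]≔false : (x : Vec Bool n) (i : Fin n) → lookup x i ≡ true →
  zeros (x [ i ]≔ false) ≡ suc (zeros x)
zeros-[]≔false (true  ∷ x) zero    refl = refl
zeros-[]≔false (false ∷ x) (suc i) xᵢ   = cong suc (zeros-[]≔false x i xᵢ)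
zeros-[]≔false (true  ∷ x) (suc i) xᵢ   = zeros-[]≔false x i xᵢ

zeros-exchange : (x : Vec Bool n) → i ≢ j → zeros (exchange x (i , j)) ≡ zeros x
zeros-exchange {i = i} {j} x i≢j with ordered? x (i , j)
... | yes o = cong zeros (exchange-ordered x o)
-- The exchange passes through `x [ i ]≔ false`, which has one zero more than either end.
... | no ¬o = ℕ.suc-injective (begin
  suc (zeros (exchange x (i , j)))
    ≡⟨ cong (suc ∘ zeros) (exchange-unordered x xᵢ xⱼ) ⟩
  suc (zeros ((x [ i ]≔ false) [ j ]≔ true))
    ≡⟨ zeros-[]≔true (x [ i ]≔ false) j (trans (lookup∘update′ (i≢j ∘ sym) x false) xⱼ) ⟨
  zeros (x [ i ]≔ false)
    ≡⟨ zeros-[]≔false x i xᵢ ⟩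
  suc (zeros x) ∎)
  where
  open ≡-Reasoning
  xᵢ = proj₁ (≰⇒true,false ¬o)
  xⱼ = proj₂ (≰⇒true,false ¬o)

zeros-run : (C : Network n d) (x : Vec Bool n) → zeros (run C x) ≡ zeros x
zeros-run C x = run-preserves (λ y → zeros y ≡ zeros x)
  (λ y i j i<j eq → trans (zeros-exchange y (Fin.<⇒≢ i<j)) eq) C x refl

zeros≡0 : (x : Vec Bool n) → (∀ k → lookup x k ≡ true) → zeros x ≡ 0
zeros≡0 []          _    = refl
zeros≡0 (true  ∷ x) ones = zeros≡0 x (ones ∘ suc)
zeros≡0 (false ∷ x) ones with () ← ones zero

sorted-tail : (x : Vec Bool n) → Sorted (b ∷ x) → Sorted x
sorted-tail x x↗ i j i≤j = x↗ (suc i) (suc j) (s≤s i≤j)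

sorted-true∷ : (x : Vec Bool n) → Sorted (true ∷ x) → ∀ k → lookup x k ≡ true
sorted-true∷ x x↗ k = true≤ (x↗ zero (suc k) z≤n) refl

-- As channels are counted from 0, `zeros x` marks where the ones of a sorted `x` begin.
sorted-true : (x : Vec Bool n) → Sorted x → zeros x ℕ.≤ toℕ k → lookup x k ≡ true
sorted-true {k = suc k} (false ∷ x) x↗ (s≤s z≤k) = sorted-true x (sorted-tail x x↗) z≤k
sorted-true {k = zero}  (true  ∷ x) x↗ _ = refl
sorted-true {k = suc k} (true  ∷ x) x↗ _ = sorted-true∷ x x↗ k

sorted-false : (x : Vec Bool n) → Sorted x → toℕ k ℕ.< zeros x → lookup x k ≡ false
sorted-false {k = zero}  (false ∷ x) x↗ _ = refl
sorted-false {k = suc k} (false ∷ x) x↗ (s≤s k<z) = sorted-false x (sorted-tail x x↗) k<z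
sorted-false             (true  ∷ x) x↗ k<z
  with () ← subst (_ ℕ.<_) (zeros≡0 x (sorted-true∷ x x↗)) k<z

-- The last layer of a sorting network

run-∷ʳ : (P : Network n d) (L : Layer n) (x : Vec Bool n) →
  run (P ∷ʳ L) x ≡ applyLayer L (run P x)
run-∷ʳ []      L x = refl
run-∷ʳ (K ∷ P) L x = run-∷ʳ P L _

module _ (P : Network n d) (L : Layer n) (sorts : IsSortingNetwork (P ∷ʳ L)) where

  private
    out : Vec Bool n → Vec Bool n
    out x = applyLayer L (run P x)

    out-sorted : ∀ x → Sorted (out x)
    out-sorted x = subst Sorted (run-∷ʳ P L x) (sorts x)

    zeros-out : ∀ x → zeros (out x) ≡ zeros x
    zeros-out x = trans (cong zeros (sym (run-∷ʳ P L x))) (zeros-run (P ∷ʳ L) x)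

    out-true : ∀ x → zeros x ℕ.≤ toℕ k → lookup (out x) k ≡ true
    out-true x z≤k = sorted-true (out x) (out-sorted x) (subst (ℕ._≤ _) (sym (zeros-out x)) z≤k)

    out-false : ∀ x → toℕ k ℕ.< zeros x → lookup (out x) k ≡ false
    out-false x k<z = sorted-false (out x) (out-sorted x) (subst (_ ℕ.<_) (sym (zeros-out x)) k<z)

  module _ (i j : Fin n) (ij∈L : (i , j) ∈ comparators L) (1+i<j : suc (toℕ i) ℕ.< toℕ j) where

    private
      -- A condition on inputs of the whole network: those for which the comparator `(i , j)` of `L`
      -- really exchanges two values.
      Swapped : Vec Bool n → Set
      Swapped x = lookup (run P x) i ≡ true × lookup (run P x) j ≡ false

      -- The exchange puts a zero at `i` in a sorted output, so the zeros reach beyond `i`. Dually,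
      -- the one put at `j` gives `zeros≤j`.
      i<zeros : ∀ x → Swapped x → toℕ i ℕ.< zeros x
      i<zeros x (yᵢ , yⱼ) = ℕ.≰⇒> λ z≤i → Bool.not-¬ (out-true x z≤i)
        (trans (applyLayer-min L (run P x) ij∈L) (cong₂ _∧_ yᵢ yⱼ))

      zeros≤j : ∀ x → Swapped x → zeros x ℕ.≤ toℕ j
      zeros≤j x (yᵢ , yⱼ) = ℕ.≮⇒≥ λ j<z → Bool.not-¬ (out-false x j<z)
        (trans (applyLayer-max L (run P x) ij∈L) (cong₂ _∨_ yᵢ yⱼ))

      -- Monotonicity keeps the zero at `j`. By the zero count the output at `j` is a one; being the
      -- maximum of the two values, it must come from `i`.
      swapped-↓ : ∀ x x′ → x′ ⊑ x → zeros x′ ℕ.≤ toℕ j → Swapped x → Swapped x′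
      swapped-↓ x x′ x′⊑x z≤j (_ , yⱼ) = yᵢ′ , yⱼ′
        where
        yⱼ′ : lookup (run P x′) j ≡ false
        yⱼ′ = ≤false (run-mono-⊑ P x′ x x′⊑x j) yⱼ
        yᵢ′ : lookup (run P x′) i ≡ true
        yᵢ′ = begin
          lookup (run P x′) i                        ≡⟨ Bool.∨-identityʳ _ ⟨
          lookup (run P x′) i ∨ false                ≡⟨ cong (_ ∨_) yⱼ′ ⟨
          lookup (run P x′) i ∨ lookup (run P x′) j  ≡⟨ applyLayer-max L _ ij∈L ⟨
          lookup (out x′) j                          ≡⟨ out-true x′ z≤j ⟩
          true                                       ∎
          where open ≡-Reasoning

      -- Dually, monotonicity keeps the one at `i`, and the minimum, delivered at `i`, is a zero by
      -- the zero count.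
      swapped-↑ : ∀ x x′ → x ⊑ x′ → toℕ i ℕ.< zeros x′ → Swapped x → Swapped x′
      swapped-↑ x x′ x⊑x′ i<z (yᵢ , _) = yᵢ′ , yⱼ′
        where
        yᵢ′ : lookup (run P x′) i ≡ true
        yᵢ′ = true≤ (run-mono-⊑ P x x′ x⊑x′ i) yᵢ
        yⱼ′ : lookup (run P x′) j ≡ false
        yⱼ′ = begin
          lookup (run P x′) j                        ≡⟨ cong (_∧ _) yᵢ′ ⟨
          lookup (run P x′) i ∧ lookup (run P x′) j  ≡⟨ applyLayer-min L _ ij∈L ⟨
          lookup (out x′) i                          ≡⟨ out-false x′ i<z ⟩
          false                                      ∎
          where open ≡-Reasoning

      -- An exchange is an increase and a decrease of single bits.  Swapped
      -- inputs have between i + 1 and j zeros, so as i + 1 < j one of the two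
      -- orders of these steps never leaves that range.
      swapped-exchange : ∀ x a b → a < b → Swapped x → Swapped (exchange x (a , b))
      swapped-exchange x a b a<b sw with ordered? x (a , b)
      ... | yes o = subst Swapped (sym (exchange-ordered x o)) sw
      ... | no ¬o with x₁ , x₀ ← ≰⇒true,false ¬o
                  with zeros x ℕ.<? toℕ j
      ...   | yes z<j =
        swapped-↑ (x [ a ]≔ false) (exchange x (a , b))
          (subst (x [ a ]≔ false ⊑_) (sym (exchange-unordered x x₁ x₀)) (⊑-[]≔true (x [ a ]≔ false) b))
          (subst (_ ℕ.<_) (sym (zeros-exchange x (Fin.<⇒≢ a<b))) (i<zeros x sw))
          (swapped-↓ x (x [ a ]≔ false) ([]≔false-⊑ x a)
            (subst (ℕ._≤ _) (sym (zeros-[]≔false x a x₁)) z<j) sw)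
      ...   | no z≮j =
        swapped-↓ (x [ b ]≔ true) (exchange x (a , b))
          (subst (_⊑ x [ b ]≔ true)
            (sym (trans (exchange-unordered x x₁ x₀) ([]≔-commutes x a b (Fin.<⇒≢ a<b))))
            ([]≔false-⊑ (x [ b ]≔ true) a))
          (subst (ℕ._≤ _) (sym (zeros-exchange x (Fin.<⇒≢ a<b))) (zeros≤j x sw))
          (swapped-↑ x (x [ b ]≔ true) (⊑-[]≔true x b)
            (s≤s⁻¹ (ℕ.≤-trans 1+i<j
              (ℕ.≤-trans (ℕ.≮⇒≥ z≮j) (ℕ.≤-reflexive (zeros-[]≔true x b x₀)))))
            sw)

    -- A swapped input would stay swapped while the network itself sorts it,
    -- but a sorted input reaches the last layer unchanged.
    nonadjacent-redundant : ∀ x → Ordered (run P x) (i , j)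
    nonadjacent-redundant x with ordered? (run P x) (i , j)
    ... | yes o = o
    ... | no ¬o = ⊥-elim (true≰false yᵢ yⱼ
      (subst (λ y → Ordered y (i , j)) (sym (run-fixes-sorted P s s↗))
        (s↗ i j (ℕ.<⇒≤ (comparator-< L ij∈L)))))
      where
      s  = run (P ∷ʳ L) x
      s↗ = sorts x
      sw : Swapped s
      sw = run-preserves Swapped swapped-exchange (P ∷ʳ L) x (≰⇒true,false ¬o)
      yᵢ = proj₁ sw
      yⱼ = proj₂ sw

-- Reaching last layer normal form

_⋖?_ : (i j : Fin n) → Dec (i ⋖ j)
i ⋖? j = toℕ j ℕ.≟ suc (toℕ i)

⋖⇒< : i ⋖ j → i < j
⋖⇒< i⋖j = ℕ.≤-reflexive (sym i⋖j)

llnf : (P : Network n d) (L : Layer n) → IsSortingNetwork (P ∷ʳ L) →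
  ∃[ L′ ] IsLLNF L′ × IsSortingNetwork (P ∷ʳ L′)
llnf {n = n} P L sorts =
  let L′ , (adj , sorts′) , noRun = saturate (uncurry _⋖?_) ⋖⇒< Q step L₀ (adj₀ , sorts₀)
  in L′
   -- Saturation with respect to adjacent pairs is exactly `noUnusedRun`.
   , record { adjacent = λ i j → All.lookup adj ; noUnusedRun = λ i j → noRun }
   , sorts′
  where
  Q : Layer n → Set
  Q L = All (uncurry _⋖_) (comparators L) × IsSortingNetwork (P ∷ʳ L)

  step : ∀ L {c} (c⋖ : uncurry _⋖_ c) (fr : Free L c) → Q L → Q (extend L c (⋖⇒< c⋖) fr)
  step L {i , j} c⋖ fr (adj , sorts) = All.∷ʳ⁺ adj c⋖ , λ x →
    subst Sorted (sym (begin
      run (P ∷ʳ extend L (i , j) (⋖⇒< c⋖) fr) x        ≡⟨ run-∷ʳ P _ x ⟩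
      applyLayer (extend L (i , j) (⋖⇒< c⋖) fr) (run P x) ≡⟨ applyLayer-extend L (⋖⇒< c⋖) fr _ ⟩
      exchange (applyLayer L (run P x)) (i , j)
        ≡⟨ cong (λ y → exchange y (i , j)) (run-∷ʳ P L x) ⟨
      exchange (run (P ∷ʳ L) x) (i , j)
        -- The appended comparator meets an output that is already sorted.
        ≡⟨ exchange-ordered _ (sorts x i j (ℕ.<⇒≤ (⋖⇒< c⋖))) ⟩
      run (P ∷ʳ L) x                                   ∎)) (sorts x)
    where open ≡-Reasoning

  L₀ : Layer n
  L₀ = record
    { comparators = filter (uncurry _⋖?_) (comparators L)
    ; ordered     = All.filter⁺ (uncurry _⋖?_) (ordered L)
    ; disjoint    = AllPairs.filter⁺ (uncurry _⋖?_) (disjoint L)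
    }

  adj₀ : All (uncurry _⋖_) (comparators L₀)
  adj₀ = All.all-filter (uncurry _⋖?_) (comparators L)

  redundant : ∀ x → All (λ c → ¬ uncurry _⋖_ c → Ordered (run P x) c) (comparators L)
  redundant x = All.tabulate λ {(i , j)} c∈L ¬⋖ →
    -- A comparator has `i < j`, so failing adjacency leaves a gap of at least two.
    nonadjacent-redundant P L sorts i j c∈L (ℕ.≤∧≢⇒< (comparator-< L c∈L) (¬⋖ ∘ sym)) x

  sorts₀ : IsSortingNetwork (P ∷ʳ L₀)
  sorts₀ x = subst Sorted (sym (begin
    run (P ∷ʳ L₀) x           ≡⟨ run-∷ʳ P L₀ x ⟩
    applyLayer L₀ (run P x)
      ≡⟨ exchanges-filter (uncurry _⋖?_) (comparators L) _ (disjoint L) (redundant x) ⟩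
    applyLayer L (run P x)    ≡⟨ run-∷ʳ P L x ⟨
    run (P ∷ʳ L) x            ∎)) (sorts x)
    where open ≡-Reasoning

-- The last but one layer

module _ (L : Layer n) (nf : IsLLNF L) (y : Vec Bool n) (out↗ : Sorted (applyLayer L y)) where

  open IsLLNF nf

  private
    out = applyLayer L y

  -- A one in channel `i` either still shows there after `L` or shows up in channel `i + 1`, and the
  -- latter only through a comparator of `L`, all of which are adjacent.
  one-reaches : lookup y i ≡ true →
    ∃[ k ] lookup out k ≡ true × (toℕ k ℕ.≤ toℕ i ⊎ (i ⋖ k × (i , k) ∈ comparators L))
  one-reaches {i} yᵢ with usedIn? L i
  ... | no i∉L = i , trans (applyLayer-unused L y i∉L) yᵢ , inj₁ ℕ.≤-refl
  ... | yes i∈L with find i∈L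
  ...   | (_ , k) , c∈L , inj₁ refl =
    k , trans (applyLayer-max L y c∈L) (cong (_∨ _) yᵢ) , inj₂ (adjacent _ _ c∈L , c∈L)
  ...   | (k , _) , c∈L , inj₂ refl =
    i , trans (applyLayer-max L y c∈L) (trans (cong (_ ∨_) yᵢ) (Bool.∨-zeroʳ _)) , inj₁ ℕ.≤-refl

  zero-reaches : lookup y j ≡ false →
    ∃[ k ] lookup out k ≡ false × (toℕ j ℕ.≤ toℕ k ⊎ (k ⋖ j × (k , j) ∈ comparators L))
  zero-reaches {j} yⱼ with usedIn? L j
  ... | no j∉L = j , trans (applyLayer-unused L y j∉L) yⱼ , inj₁ ℕ.≤-refl
  ... | yes j∈L with find j∈L
  ...   | (_ , k) , c∈L , inj₁ refl =
    j , trans (applyLayer-min L y c∈L) (cong (_∧ _) yⱼ) , inj₁ ℕ.≤-refl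
  ...   | (k , _) , c∈L , inj₂ refl =
    k , trans (applyLayer-min L y c∈L) (trans (cong (_ ∧_) yⱼ) (Bool.∧-zeroʳ _))
      , inj₂ (adjacent _ _ c∈L , c∈L)

  -- The one of `i` ends at some `k ≤ i + 1`, the zero of `j` at some `l ≥ j - 1`, and sortedness
  -- demands `l < k`. Hence `j ≤ l + 1 ≤ k ≤ i + 1 ≤ j`, and `k` is `j`.
  unordered⇒comparator : i < j → ¬ Ordered y (i , j) → (i , j) ∈ comparators L
  unordered⇒comparator {i} {j} i<j ¬o
    with yᵢ , yⱼ ← ≰⇒true,false ¬o
    with k , oₖ , k-near-i ← one-reaches yᵢ
       | l , oₗ , l-near-j ← zero-reaches yⱼ
    = locate k-near-i l-near-j
    where
    l<k : l < k
    l<k = ℕ.≰⇒> λ k≤l → true≰false oₖ oₗ (out↗ k l k≤l)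

    locate : toℕ k ℕ.≤ toℕ i ⊎ (i ⋖ k × (i , k) ∈ comparators L) →
             toℕ j ℕ.≤ toℕ l ⊎ (l ⋖ j × (l , j) ∈ comparators L) →
             (i , j) ∈ comparators L
    -- The two values can pass each other only if both move; the first three cases leave no room for
    -- `l < k`.
    locate (inj₁ k≤i) (inj₁ j≤l) =
      ⊥-elim (ℕ.<-asym i<j (ℕ.≤-<-trans j≤l (ℕ.<-≤-trans l<k k≤i)))
    locate (inj₁ k≤i) (inj₂ (l⋖j , _)) =
      ⊥-elim (ℕ.<⇒≱ i<j (ℕ.≤-trans (ℕ.≤-reflexive l⋖j) (ℕ.≤-trans l<k k≤i)))
    locate (inj₂ (i⋖k , _)) (inj₁ j≤l) =
      ⊥-elim (ℕ.<⇒≱ i<j (ℕ.≤-trans j≤l (s≤s⁻¹ (ℕ.≤-trans l<k (ℕ.≤-reflexive i⋖k)))))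
    locate (inj₂ (i⋖k , ik∈L)) (inj₂ (l⋖j , _)) =
      subst (λ m → (i , m) ∈ comparators L) (Fin.toℕ-injective k≡j) ik∈L
      where
      k≡j : toℕ k ≡ toℕ j
      k≡j = ℕ.≤-antisym (ℕ.≤-trans (ℕ.≤-reflexive i⋖k) i<j)
                        (ℕ.≤-trans (ℕ.≤-reflexive l⋖j) l<k)

  applyLayer-exchange : i < j → applyLayer L (exchange y (i , j)) ≡ out
  applyLayer-exchange {i} {j} i<j with ordered? y (i , j)
  ... | yes o = cong (applyLayer L) (exchange-ordered y o)
  ... | no ¬o = exchanges-absorb y (disjoint L) (Fin.<⇒≢ i<j) (unordered⇒comparator i<j ¬o)

saturate-penultimate : (P : Network n d) (K L : Layer n) → IsLLNF L →
  IsSortingNetwork ((P ∷ʳ K) ∷ʳ L) →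
  ∃[ K′ ] IsSortingNetwork ((P ∷ʳ K′) ∷ʳ L) × (∀ {c} → uncurry _<_ c → ¬ Free K′ c)
saturate-penultimate {n = n} P K L nf =
  saturate (uncurry _<?_) (λ i<j → i<j) Q step K
  where
  Q : Layer n → Set
  Q K = IsSortingNetwork ((P ∷ʳ K) ∷ʳ L)

  run-PKL : ∀ K x → run ((P ∷ʳ K) ∷ʳ L) x ≡ applyLayer L (applyLayer K (run P x))
  run-PKL K x = trans (run-∷ʳ (P ∷ʳ K) L x) (cong (applyLayer L) (run-∷ʳ P K x))

  step : ∀ K {c} (c< : uncurry _<_ c) (fr : Free K c) → Q K → Q (extend K c c< fr)
  step K {i , j} c< fr sorts x = subst Sorted (sym (begin
    run ((P ∷ʳ extend K (i , j) c< fr) ∷ʳ L) x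
      ≡⟨ run-PKL (extend K (i , j) c< fr) x ⟩
    applyLayer L (applyLayer (extend K (i , j) c< fr) (run P x))
      ≡⟨ cong (applyLayer L) (applyLayer-extend K c< fr (run P x)) ⟩
    applyLayer L (exchange (applyLayer K (run P x)) (i , j))
      ≡⟨ applyLayer-exchange L nf _ out↗ c< ⟩
    applyLayer L (applyLayer K (run P x)) ∎)) out↗
    where
    open ≡-Reasoning
    out↗ = subst Sorted (run-PKL K x) (sorts x)

-- From saturated layers to co-saturation

layer-∷ʳ-≤ : (P : Network n d) (L : Layer n) (ℓ : ℕ) → ℓ ℕ.≤ d → layer (P ∷ʳ L) ℓ ≡ layer P ℓ
layer-∷ʳ-≤ []      L zero          _         = refl
layer-∷ʳ-≤ (K ∷ P) L zero          _         = refl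
layer-∷ʳ-≤ (K ∷ P) L (suc zero)    _         = refl
layer-∷ʳ-≤ (K ∷ P) L (suc (suc ℓ)) (s≤s ℓ<d) = layer-∷ʳ-≤ P L (suc ℓ) ℓ<d

lastLayer-∷ʳ : (P : Network n d) (L : Layer n) → lastLayer (P ∷ʳ L) ≡ L
lastLayer-∷ʳ []           L = refl
lastLayer-∷ʳ (K ∷ [])     L = refl
lastLayer-∷ʳ (K ∷ K′ ∷ P) L = lastLayer-∷ʳ (K′ ∷ P) L

-- Layers are numbered from the front, while the construction splits them off the back; this bridges
-- the two.
penultimateLayer-∷ʳ : (P : Network n d) (K L : Layer n) → penultimateLayer ((P ∷ʳ K) ∷ʳ L) ≡ K
penultimateLayer-∷ʳ P K L =
  trans (layer-∷ʳ-≤ (P ∷ʳ K) L _ ℕ.≤-refl) (lastLayer-∷ʳ P K)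

-- A violation of either remaining condition exhibits two distinct channels, hence a comparator,
-- free in the penultimate layer.
saturated⇒coSaturated : (C : Network n d) → IsLLNF (lastLayer C) →
  (∀ {c} → uncurry _<_ c → ¬ Free (penultimateLayer C) c) → IsCoSaturated C
saturated⇒coSaturated C nf sat = record
  { llnf                = nf
  ; noConsecutiveUnused = λ _ _ (B<B′ , _) ((k , k∈B , k∉K) , (k′ , k′∈B′ , k′∉K)) →
      sat (B<B′ k k′ k∈B k′∈B′) (k∉K , k′∉K)
  ; neighboursUsed      = λ i j i⋖j _ i∉K j∉K → ⊥-elim (sat (⋖⇒< i⋖j) (i∉K , j∉K))
  }

-- Depth at most one

⋖-zero : n ℕ.≤ 2 → {i j : Fin n} → i ⋖ j → toℕ i ≡ 0
⋖-zero n≤2 {i} {j} i⋖j = ℕ.n≤0⇒n≡0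
  (s≤s⁻¹ (s≤s⁻¹ (ℕ.≤-trans (subst (ℕ._< _) i⋖j (Fin.toℕ<n j)) n≤2)))

-- Only `(0 , 1)` can be adjacent.
⋖-unique : n ℕ.≤ 2 → {i j k l : Fin n} → i ⋖ j → k ⋖ l → (i , j) ≡ (k , l)
⋖-unique n≤2 i⋖j k⋖l = cong₂ _,_ (Fin.toℕ-injective i≡k)
  (Fin.toℕ-injective (trans i⋖j (trans (cong suc i≡k) (sym k⋖l))))
  where i≡k = trans (⋖-zero n≤2 i⋖j) (sym (⋖-zero n≤2 k⋖l))

-- Serves depth at most one, where the penultimate layer counts as empty and cannot be saturated.
-- Instead, two channels are too few for consecutive blocks, or for a neighbour outside an adjacent
-- pair.
small⇒coSaturated : n ℕ.≤ 2 → (C : Network n d) → IsLLNF (lastLayer C) → IsCoSaturated C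
small⇒coSaturated {n} n≤2 C nf = record
  { llnf                = nf
  ; noConsecutiveUnused = λ { _ _ (B<B′ , k , k′ , k∈B , k′∈B′ , k⋖k′) _ →
      -- By `edge` the first block contains `k′` as well, so `k′` would have to precede itself.
      ℕ.<-irrefl refl (B<B′ k′ k′ (transitive _ k∈B (return (edge k⋖k′))) k′∈B′) }
  ; neighboursUsed      = λ i j i⋖j _ _ _ →
        (λ k k⋖i → ⊥-elim (ℕ.0≢1+n (trans (sym (⋖-zero n≤2 i⋖j)) k⋖i)))
      , (λ k j⋖k → ⊥-elim (ℕ.0≢1+n (trans (sym (⋖-zero n≤2 j⋖k)) i⋖j)))
  }
  where
  L = lastLayer C
  open IsLLNF nf

  edge : i ⋖ j → (i , j) ∈ comparators L
  edge {i} {j} i⋖j with free? L (i , j)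
  ... | yes fr = ⊥-elim (noUnusedRun i j i⋖j fr)
  ... | no ¬fr with comparators L in eq
  ...   | []    = ⊥-elim (¬fr ((λ ()) , (λ ())))
  -- Any comparator of `L` is adjacent, hence is `(i , j)` itself.
  ...   | c ∷ _ = here (⋖-unique n≤2 i⋖j
    (adjacent _ _ (subst (c ∈_) (sym eq) (here refl))))

-- On three or more channels, channel 0 can meet only channel 1; if both hold a one, a one stays on
-- top although there are zeros below.
depth-one⇒small : (L : Layer n) → IsLLNF L → IsSortingNetwork (L ∷ []) → n ℕ.≤ 2
depth-one⇒small {zero}  L nf sorts = z≤n
depth-one⇒small {suc zero} L nf sorts = s≤s z≤n
depth-one⇒small {suc (suc zero)} L nf sorts = s≤s (s≤s z≤n)
depth-one⇒small {suc (suc (suc n))} L nf sorts =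
  ⊥-elim (Bool.not-¬ (sorted-false {k = zero} (applyLayer L x) (sorts x) 0<zeros) out₀)
  where
  open IsLLNF nf
  x : Vec Bool (suc (suc (suc n)))
  x = true ∷ true ∷ false ∷ replicate n false

  0<zeros : 0 ℕ.< zeros (applyLayer L x)
  0<zeros = subst (0 ℕ.<_) (sym (zeros-run (L ∷ []) x)) (s≤s z≤n)

  out₀ : lookup (applyLayer L x) zero ≡ true
  out₀ with usedIn? L zero
  ... | no 0∉L = applyLayer-unused L x 0∉L
  ... | yes 0∈L with find 0∈L
  ...   | (_ , suc zero)    , c∈L , inj₁ refl = applyLayer-min L x c∈L
  ...   | (_ , zero)        , c∈L , inj₁ refl with () ← adjacent _ _ c∈L
  ...   | (_ , suc (suc _)) , c∈L , inj₁ refl with () ← adjacent _ _ c∈L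
  ...   | (_ , _)           , c∈L , inj₂ refl with () ← adjacent _ _ c∈L

depth-zero⇒small : IsSortingNetwork {n} [] → n ℕ.≤ 1
depth-zero⇒small {zero}        sorts = z≤n
depth-zero⇒small {suc zero}    sorts = s≤s z≤n
depth-zero⇒small {suc (suc n)} sorts
  with () ← sorts (true ∷ replicate (suc n) false) zero (suc zero) z≤n

theorem4 : ∀ (n d : ℕ) (C : Network n d) → IsSortingNetwork C →
    ∃[ N ] IsSortingNetwork {n} {d} N × IsCoSaturated {n} {d} N
theorem4 n zero [] sorts = [] , sorts
  , small⇒coSaturated (ℕ.m≤n⇒m≤1+n n≤1) [] record
      { adjacent    = λ _ _ ()
      ; noUnusedRun = λ i j i⋖j _ →
          ℕ.<⇒≱ (ℕ.≤-<-trans (s≤s z≤n) (subst (ℕ._< n) i⋖j (Fin.toℕ<n j))) n≤1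
      }
  where n≤1 = depth-zero⇒small sorts
theorem4 n (suc zero) (L ∷ []) sorts =
  let L′ , nf , sorts′ = llnf [] L sorts
  in L′ ∷ [] , sorts′ , small⇒coSaturated (depth-one⇒small L′ nf sorts′) (L′ ∷ []) nf
theorem4 n (suc (suc d)) C sorts
  with C′ , L , refl ← initLast C
  with P , K , refl ← initLast C′ =
  -- The last layer is treated first: extending the one before relies on its normal form and leaves
  -- it untouched.
  let L′ , nf , sorts′ = llnf (P ∷ʳ K) L sorts
      K′ , sorts″ , sat = saturate-penultimate P K L′ nf sorts′
      N = (P ∷ʳ K′) ∷ʳ L′
  in N , sorts″ , saturated⇒coSaturated N
       (subst IsLLNF (sym (lastLayer-∷ʳ (P ∷ʳ K′) L′)) nf)
       (subst (λ M → ∀ {c} → uncurry _<_ c → ¬ Free M c) (sym (penultimateLayer-∷ʳ P K′ L′)) sat)
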